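{- For all integers $n\geq 0$, $c_{9}(n)\equiv 1 \pmod 2$ if $n=(5j^{2}+j)/2$ for some $j\in\mathbb{Z}$, and $c_{9}(n)\equiv 0 \pmod 2$ otherwise.
   Context: A partition of $n$ is a finite non-increasing sequence of positive integers (its parts) summing to $n$. Let $c_{9}(n)$ be the number of partitions of $n$ in which either (a) all parts are distinct and greater than $1$, or (b) there is an integer $j\geq 2$ such that the part $1$ appears exactly $j^{2}$ times and all parts greater than $1$ are distinct and at least $j+1$. -}

module Defs where

open import Data.Nat using (ℕ; zero; suc; _+_; _*_; _≤_; _<_; _≤?_; _<?_; _≟_)
open import Data.List using (List; []; _∷_; length; filter; concatMap; map; sum; upTo; applyUpTo)
open import Data.List.Relation.Unary.All using (All; all?)
open import Data.List.Relation.Unary.Any using (Any; any?)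
open import Data.List.Relation.Unary.AllPairs using (AllPairs; allPairs?)
open import Data.List.Relation.Unary.Unique.Propositional using (Unique)
open import Data.Product using (_×_; Σ; _,_)
open import Data.Sum using (_⊎_)
open import Relation.Nullary using (Dec; ¬_)
open import Relation.Nullary.Decidable using (_×-dec_; _⊎-dec_; ¬?)
open import Relation.Binary.PropositionalEquality using (_≡_)

-- A partition is represented by the list of its parts in non-increasing order.

-- partsBounded n m : all non-increasing lists of positive integers,
-- each part ≤ m, summing to n.  Defined by recursion on a fuel k ≥ n.
partsAux : ℕ → ℕ → ℕ → List (List ℕ)
partsAux _       zero    m = [] ∷ []
partsAux zero    (suc n) m = []
partsAux (suc k) (suc n) m =
  concatMap (λ p → map (p ∷_) (partsAux k (suc n Data.Nat.∸ p) p))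
            (filter (λ p → p ≤? suc n) (applyUpTo suc m))

partitions : ℕ → List (List ℕ)
partitions n = partsAux n n n

ones : List ℕ → ℕ
ones [] = 0
ones (x ∷ xs) with x ≟ 1
... | Relation.Nullary.yes _ = suc (ones xs)
... | Relation.Nullary.no _  = ones xs

big : List ℕ → List ℕ
big = filter (λ x → 1 <? x)

condA : List ℕ → Set
condA λs = Unique λs × All (λ x → 1 < x) λs

condBj : List ℕ → ℕ → Set
condBj λs j = 2 ≤ j × ones λs ≡ j * j × Unique (big λs) × All (λ x → suc j ≤ x) (big λs)

-- condition (b): some j ≥ 2 works (any such j satisfies j ≤ j² ≤ n, so the
-- search over j < n+1 is exhaustive)
condB : ℕ → List ℕ → Set
condB n λs = Any (condBj λs) (upTo (suc n))

uniq? : (xs : List ℕ) → Dec (Unique xs)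
uniq? = allPairs? (λ x y → ¬? (x ≟ y))

condA? : (λs : List ℕ) → Dec (condA λs)
condA? λs = uniq? λs ×-dec all? (λ x → 1 <? x) λs

condBj? : (λs : List ℕ) (j : ℕ) → Dec (condBj λs j)
condBj? λs j = (2 ≤? j) ×-dec ((ones λs ≟ j * j) ×-dec
  (uniq? (big λs) ×-dec all? (λ x → suc j ≤? x) (big λs)))

condB? : (n : ℕ) (λs : List ℕ) → Dec (condB n λs)
condB? n λs = any? (condBj? λs) (upTo (suc n))

c9? : (n : ℕ) (λs : List ℕ) → Dec (condA λs ⊎ condB n λs)
c9? n λs = condA? λs ⊎-dec condB? n λs

c9 : ℕ → ℕ
c9 n = length (filter (c9? n) (partitions n))

{-# OPTIONS --safe #-}

-- Modulo 2, the cases j = 0 and j = 1 of Σ_{j≥0} q^(j²) (−q^(j+1); q)_∞ add up to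
-- (1 + 2q)(−q²; q)_∞ ≡ (−q²; q)_∞, which counts condition (a).  Hence the generating
-- function of c₉ is congruent to the whole sum, that is, to (q; q)_∞ Σ q^(j²)/(q; q)_j, and
-- by the first Rogers–Ramanujan identity and the Jacobi triple product this is
-- Σ_{j∈ℤ} (−1)^j q^((5j²+j)/2).  The equality of these two sums is proved in Rogers' way:
-- with a parameter x = q^m, both satisfy g(m) = g(m+1) + q^(m+1) g(m+2).
module Submission where

open import Defs
open import Data.Bool using (Bool; true; false; not; _xor_)
open import Data.Bool.Properties using (xor-same; xor-identityʳ; xor-assoc)
open import Data.Bool.Solver using (module xor-∧-Solver)
import Data.Integer as ℤ
import Data.Integer.Properties as ℤ
import Data.Integer.Tactic.RingSolver as ℤSolver
open import Data.List using (List; []; _∷_; _++_; _∷ʳ_; length; filter; concatMap; map; applyUpTo)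
open import Data.List.Properties using (applyUpTo-∷ʳ; filter-++; filter-all; filter-none; concatMap-++; ++-identityʳ)
open import Data.List.Relation.Unary.All as All using (All; []; _∷_)
import Data.List.Relation.Unary.All.Properties as All
open import Data.List.Relation.Unary.AllPairs using ([]; _∷_)
open import Data.List.Relation.Unary.Any using (any?; satisfied)
open import Data.List.Relation.Unary.Unique.Propositional using (Unique)
open import Data.Nat using (ℕ; _%_; zero; suc; _∸_; _≤_; _<_; z≤n; s≤s; _≤?_; _≟_; _<?_)
open import Data.Nat.Properties
open import Data.Nat.Tactic.RingSolver using (solve-∀)
open import Data.Product using (_×_; ∃; _,_)
open import Function using (_∘_; mk⇔)
open import Relation.Binary using (tri<; tri≈; tri>)
open import Relation.Binary.PropositionalEquality
open import Relation.Nullary using (¬_; Dec; yes; no; does; contradiction)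
open import Relation.Nullary.Decidable using (_×-dec_; _⊎-dec_; does-⇔; dec-true; dec-false)
open import Relation.Unary using (Decidable)

-- Over the field with two elements signs disappear, so 1 - q^k becomes 1 + q^k and a series is a
-- function `ℕ → Bool`. The obstacle is that the identity involves quotients by (q;q)_j together
-- with infinite sums and products. Multiplying by (q;q)_∞ turns each quotient on the sum side into
-- the product of the factors beyond j, and on Rogers' side leaves finite products of m factors, so
-- no division remains. The infinite objects are then cut off at an order L: each statement compares
-- one coefficient c with c ≤ L, and whatever is cut off begins beyond q^c. The parameter m is what
-- makes a recurrence available at all, and the recurrence pins down the solution because q^m tends
-- to 0: once m ≥ c, both sides have the same coefficient at q^c.

module RogersRamanujan where

  open import Data.Nat using (_+_; _*_)

  -- Power series over the field with two elements.

  Series : Set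
  Series = ℕ → Bool

  δ : Series
  δ zero    = true
  δ (suc _) = false

  shift : ℕ → Series → Series
  shift zero    f c       = f c
  shift (suc k) f zero    = false
  shift (suc k) f (suc c) = shift k f c

  [1+q^_]_ : ℕ → Series → Series
  ([1+q^ k ] f) c = f c xor shift k f c

  -- The hypothesis is confined to d ≤ c because the truncated identities below hold only up to some
  -- order and still have to be applied under a shift.
  shift-cong : ∀ a {f g : Series} c → (∀ d → d ≤ c → f d ≡ g d) → shift a f c ≡ shift a g c
  shift-cong zero    c       f≡g = f≡g c ≤-refl
  shift-cong (suc a) zero    f≡g = refl
  shift-cong (suc a) (suc c) f≡g = shift-cong a c (λ d d≤c → f≡g d (m≤n⇒m≤1+n d≤c))

  shift-cong-≗ : ∀ a {f g : Series} → f ≗ g → shift a f ≗ shift a g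
  shift-cong-≗ a f≗g c = shift-cong a c (λ d _ → f≗g d)

  shift-+ : ∀ a b f → shift (a + b) f ≗ shift a (shift b f)
  shift-+ zero    b f c       = refl
  shift-+ (suc a) b f zero    = refl
  shift-+ (suc a) b f (suc c) = shift-+ a b f c

  shift-xor : ∀ a (f g : Series) c →
    shift a (λ d → f d xor g d) c ≡ shift a f c xor shift a g c
  shift-xor zero    f g c       = refl
  shift-xor (suc a) f g zero    = refl
  shift-xor (suc a) f g (suc c) = shift-xor a f g c

  shift-small : ∀ a f {c} → c < a → shift a f c ≡ false
  shift-small (suc a) f {zero}  _         = refl
  shift-small (suc a) f {suc c} (s≤s c<a) = shift-small a f c<a

  shift-exact : ∀ a f c → shift a f (a + c) ≡ f c
  shift-exact zero    f c = refl
  shift-exact (suc a) f c = shift-exact a f c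

  [1+q^]-cong : ∀ k {f g} → f ≗ g → [1+q^ k ] f ≗ [1+q^ k ] g
  [1+q^]-cong k f≗g c = cong₂ _xor_ (f≗g c) (shift-cong-≗ k f≗g c)

  shift-[1+q^] : ∀ a k f c → shift a ([1+q^ k ] f) c ≡ shift a f c xor shift (a + k) f c
  shift-[1+q^] a k f c =
    trans (shift-xor a f (shift k f) c) (cong (shift a f c xor_) (sym (shift-+ a k f c)))

  [1+q^]-comm : ∀ a b f → [1+q^ a ] ([1+q^ b ] f) ≗ [1+q^ b ] ([1+q^ a ] f)
  [1+q^]-comm a b f c = begin
    (f c xor shift b f c) xor shift a ([1+q^ b ] f) c
      ≡⟨ cong ((f c xor shift b f c) xor_) (shift-[1+q^] a b f c) ⟩
    (f c xor shift b f c) xor (shift a f c xor shift (a + b) f c)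
      ≡⟨ cong (λ e → (f c xor shift b f c) xor (shift a f c xor shift e f c)) (+-comm a b) ⟩
    (f c xor shift b f c) xor (shift a f c xor shift (b + a) f c)
      ≡⟨ solve 4 (λ w x y z → (w :+ x) :+ (y :+ z) := (w :+ y) :+ (x :+ z)) refl
           (f c) (shift b f c) (shift a f c) (shift (b + a) f c) ⟩
    (f c xor shift a f c) xor (shift b f c xor shift (b + a) f c)
      ≡⟨ cong ((f c xor shift a f c) xor_) (sym (shift-[1+q^] b a f c)) ⟩
    (f c xor shift a f c) xor shift b ([1+q^ a ] f) c ∎
    where open ≡-Reasoning
          open xor-∧-Solver

  -- Finite products and sums.

  -- ∏ n m = (1 + q^(n+1)) ⋯ (1 + q^(n+m))
  ∏ : ℕ → ℕ → Series
  ∏ n zero    = δ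
  ∏ n (suc m) = [1+q^ suc (n + m) ] ∏ n m

  -- The factors commute. The definition peels off the highest factor, as a count by largest part
  -- does; the recurrences in m also need to peel off the lowest.
  ∏-unfoldˡ : ∀ n m → ∏ n (suc m) ≗ [1+q^ suc n ] ∏ (suc n) m
  ∏-unfoldˡ n zero    c = cong (λ e → ([1+q^ suc e ] δ) c) (+-identityʳ n)
  ∏-unfoldˡ n (suc m) c = begin
    ([1+q^ suc (n + suc m) ] ∏ n (suc m)) c
      ≡⟨ [1+q^]-cong (suc (n + suc m)) (∏-unfoldˡ n m) c ⟩
    ([1+q^ suc (n + suc m) ] ([1+q^ suc n ] ∏ (suc n) m)) c
      ≡⟨ [1+q^]-comm (suc (n + suc m)) (suc n) (∏ (suc n) m) c ⟩
    ([1+q^ suc n ] ([1+q^ suc (n + suc m) ] ∏ (suc n) m)) c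
      ≡⟨ cong (λ e → ([1+q^ suc n ] ([1+q^ suc e ] ∏ (suc n) m)) c) (+-suc n m) ⟩
    ([1+q^ suc n ] ∏ (suc n) (suc m)) c ∎
    where open ≡-Reasoning

  ∏-stable : ∀ n {l m c} → c ≤ l → c ≤ m → ∏ n l c ≡ ∏ n m c
  ∏-stable n {l} {m} {c} c≤l c≤m =
    trans (to-exact l c≤l) (sym (to-exact m c≤m))
    where
    extend : ∀ d → ∏ n (d + c) c ≡ ∏ n c c
    extend zero    = refl
    extend (suc d) = trans
      (cong (∏ n (d + c) c xor_) (shift-small _ (∏ n (d + c)) (s≤s (≤-trans (m≤n+m c d) (m≤n+m (d + c) n)))))
      (trans (xor-identityʳ _) (extend d))
    to-exact : ∀ l → c ≤ l → ∏ n l c ≡ ∏ n c c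
    to-exact l c≤l = trans (cong (λ e → ∏ n e c) (sym (m∸n+n≡m c≤l))) (extend (l ∸ c))

  ∑ : ℕ → (ℕ → Bool) → Bool
  ∑ zero    f = false
  ∑ (suc n) f = f 0 xor ∑ n (f ∘ suc)

  ∑-cong : ∀ n {f g} → (∀ i → i < n → f i ≡ g i) → ∑ n f ≡ ∑ n g
  ∑-cong zero    f≡g = refl
  ∑-cong (suc n) f≡g = cong₂ _xor_ (f≡g 0 (s≤s z≤n)) (∑-cong n (λ i i<n → f≡g (suc i) (s≤s i<n)))

  ∑-xor : ∀ n f g → ∑ n (λ i → f i xor g i) ≡ ∑ n f xor ∑ n g
  ∑-xor zero    f g = refl
  ∑-xor (suc n) f g = trans (cong ((f 0 xor g 0) xor_) (∑-xor n (f ∘ suc) (g ∘ suc)))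
    (solve 4 (λ w x y z → (w :+ x) :+ (y :+ z) := (w :+ y) :+ (x :+ z)) refl
       (f 0) (g 0) (∑ n (f ∘ suc)) (∑ n (g ∘ suc)))
    where open xor-∧-Solver

  ∑-false : ∀ n {f} → (∀ i → i < n → f i ≡ false) → ∑ n f ≡ false
  ∑-false zero    f≡0 = refl
  ∑-false (suc n) f≡0 = cong₂ _xor_ (f≡0 0 (s≤s z≤n)) (∑-false n (λ i i<n → f≡0 (suc i) (s≤s i<n)))

  ∑-single : ∀ n f i → i < n → (∀ k → k ≢ i → f k ≡ false) → ∑ n f ≡ f i
  ∑-single (suc n) f zero    i<n f≡0 =
    trans (cong (f 0 xor_) (∑-false n (λ k _ → f≡0 (suc k) (λ ())))) (xor-identityʳ _)
  ∑-single (suc n) f (suc i) (s≤s i<n) f≡0 =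
    cong₂ _xor_ (f≡0 0 (λ ())) (∑-single n (f ∘ suc) i i<n (λ k k≢i → f≡0 (suc k) (k≢i ∘ suc-injective)))

  ∑-last : ∀ n f → ∑ (suc n) f ≡ ∑ n f xor f n
  ∑-last zero    f = xor-identityʳ (f 0)
  ∑-last (suc n) f = trans (cong (f 0 xor_) (∑-last n (f ∘ suc))) (sym (xor-assoc (f 0) _ _))

  -- The index shift of an infinite sum, in truncated form: in its uses `f n` vanishes because its
  -- exponent exceeds the coefficient under consideration.
  ∑-reindex : ∀ n f → f 0 ≡ false → f n ≡ false → ∑ n f ≡ ∑ n (f ∘ suc)
  ∑-reindex n f f0 fn = trans (sym (trans (cong (∑ n f xor_) fn) (xor-identityʳ _)))
    (trans (sym (∑-last n f)) (cong (_xor ∑ n (f ∘ suc)) f0))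

  shift-∑ : ∀ a n (F : ℕ → Series) c →
    shift a (λ d → ∑ n (λ i → F i d)) c ≡ ∑ n (λ i → shift a (F i) c)
  shift-∑ zero    n F c       = refl
  shift-∑ (suc a) n F zero    = sym (∑-false n (λ _ _ → refl))
  shift-∑ (suc a) n F (suc c) = shift-∑ a n F c

  -- The sum side and its recurrence in m.

  -- The left-hand side of the Rogers–Ramanujan identity at x = q^m, multiplied by
  -- (q;q)_L and without its terms beyond j = L.
  sumSide : ℕ → ℕ → Series
  sumSide L m c = ∑ (suc L) (λ j → shift (j * j + m * j) (∏ j (L ∸ j)) c)

  -- The difference of the terms at m and m+1 carries the factor 1 - q^j. It cancels the term j = 0,
  -- and for j+1 it is the factor that extends the product beyond j+1 to the product beyond j. Since
  -- (j+1)² + m(j+1) = (m+1) + j² + (m+2)j, the result is the term j at m+2, shifted by m+1.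
  sumSide-rec : ∀ L m {c} → c ≤ L →
    sumSide L m c ≡ sumSide L (suc m) c xor shift (suc m) (sumSide L (2 + m)) c
  sumSide-rec L m {c} c≤L = begin
    ∑ (suc L) (h m)
      ≡⟨ solve 2 (λ x y → x := y :+ (x :+ y)) refl (∑ (suc L) (h m)) (∑ (suc L) (h (suc m))) ⟩
    ∑ (suc L) (h (suc m)) xor (∑ (suc L) (h m) xor ∑ (suc L) (h (suc m)))
      ≡⟨ cong (∑ (suc L) (h (suc m)) xor_) (sym (∑-xor (suc L) (h m) (h (suc m)))) ⟩
    ∑ (suc L) (h (suc m)) xor ((h m 0 xor h (suc m) 0) xor ∑ L (λ j → h m (suc j) xor h (suc m) (suc j)))
      ≡⟨ cong (∑ (suc L) (h (suc m)) xor_) (cong₂ _xor_ first (∑-cong L later)) ⟩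
    ∑ (suc L) (h (suc m)) xor ∑ L t
      -- The index shift leaves only j < L; the term j = L may be added because its exponent exceeds
      -- L ≥ c.
      ≡⟨ cong (∑ (suc L) (h (suc m)) xor_) (trans (sym (xor-identityʳ _))
           (trans (cong (∑ L t xor_) (sym last)) (sym (∑-last L t)))) ⟩
    ∑ (suc L) (h (suc m)) xor ∑ (suc L) t
      ≡⟨ cong (∑ (suc L) (h (suc m)) xor_) (sym (shift-∑ (suc m) (suc L) (λ j → shift (j * j + (2 + m) * j) (∏ j (L ∸ j))) c)) ⟩
    ∑ (suc L) (h (suc m)) xor shift (suc m) (sumSide L (2 + m)) c ∎
    where
    open ≡-Reasoning
    open xor-∧-Solver
    h : ℕ → ℕ → Bool
    h m j = shift (j * j + m * j) (∏ j (L ∸ j)) c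
    t : ℕ → Bool
    t j = shift (suc m) (shift (j * j + (2 + m) * j) (∏ j (L ∸ j))) c
    first : h m 0 xor h (suc m) 0 ≡ false
    first = trans (cong (λ e → shift e (∏ 0 L) c xor h (suc m) 0) (trans (*-zeroʳ m) (sym (*-zeroʳ (suc m)))))
                  (xor-same (h (suc m) 0))
    exponent₁ : ∀ m j → suc j * suc j + suc m * suc j ≡ suc j * suc j + m * suc j + suc j
    exponent₁ = solve-∀
    exponent₂ : ∀ m j → suc j * suc j + m * suc j ≡ suc m + (j * j + (2 + m) * j)
    exponent₂ = solve-∀
    later : ∀ j → j < L → h m (suc j) xor h (suc m) (suc j) ≡ t j
    later j j<L = begin
      h m (suc j) xor h (suc m) (suc j)
        ≡⟨ cong (λ e → h m (suc j) xor shift e p c) (exponent₁ m j) ⟩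
      shift a p c xor shift (a + suc j) p c
        ≡⟨ sym (shift-[1+q^] a (suc j) p c) ⟩
      shift a ([1+q^ suc j ] p) c
        ≡⟨ sym (shift-cong-≗ a (∏-unfoldˡ j (L ∸ suc j)) c) ⟩
      shift a (∏ j (suc (L ∸ suc j))) c
        ≡⟨ cong₂ (λ e l → shift e (∏ j l) c) (exponent₂ m j) (sym (+-∸-assoc 1 j<L)) ⟩
      shift (suc m + (j * j + (2 + m) * j)) (∏ j (L ∸ j)) c
        ≡⟨ shift-+ (suc m) (j * j + (2 + m) * j) (∏ j (L ∸ j)) c ⟩
      t j ∎
      where
      a = suc j * suc j + m * suc j
      p = ∏ (suc j) (L ∸ suc j)
    last : t L ≡ false
    last = trans (sym (shift-+ (suc m) (L * L + (2 + m) * L) (∏ L (L ∸ L)) c))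
      (shift-small (suc m + (L * L + (2 + m) * L)) _
        (s≤s (≤-trans c≤L (≤-trans (m≤m+n L _) (≤-trans (m≤n+m _ (L * L)) (m≤n+m _ m))))))

  -- Every term with j ≥ 1 starts at j² + mj > m ≥ c, so only j = 0 contributes.
  sumSide-limit : ∀ L m {c} → c ≤ m → sumSide L m c ≡ ∏ 0 L c
  sumSide-limit L m {c} c≤m = trans
    (∑-single (suc L) (λ j → shift (j * j + m * j) (∏ j (L ∸ j)) c) 0 (s≤s z≤n)
      λ { zero k≢0 → contradiction refl k≢0
        ; (suc j) _ → shift-small _ (∏ (suc j) (L ∸ suc j)) (s≤s (≤-trans c≤m
                                (≤-trans (m≤m*n m (suc j)) (m≤n+m _ (j + j * suc j))))) })
    (cong (λ e → shift e (∏ 0 L) c) (*-zeroʳ m))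

  -- Rogers' series and their recurrences.

  -- ε m n = 2mn + n(5n+1)/2
  ε : ℕ → ℕ → ℕ
  ε m zero    = 0
  ε m (suc n) = ε m n + (2 * m + 5 * n + 3)

  ε-suc : ∀ m n → ε (suc m) n ≡ ε m n + 2 * n
  ε-suc m zero    = refl
  ε-suc m (suc n) = trans (cong (_+ (2 * suc m + 5 * n + 3)) (ε-suc m n)) (arith (ε m n) m n)
    where
    arith : ∀ e m n → e + 2 * n + (2 * suc m + 5 * n + 3) ≡ e + (2 * m + 5 * n + 3) + 2 * suc n
    arith = solve-∀

  n≤ε : ∀ m n → n ≤ ε m n
  n≤ε m zero    = z≤n
  n≤ε m (suc n) = subst (_≤ ε m n + (2 * m + 5 * n + 3)) (+-comm n 1)
    (+-mono-≤ (n≤ε m n) (≤-trans (s≤s z≤n) (m≤n+m 3 (2 * m + 5 * n))))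

  -- Rogers' series Q_{2,2}(x) and Q_{2,1}(x) at x = q^m, multiplied by (q;q)_∞; the
  -- factor (xq;q)_n (q;q)_∞ / ((q;q)_n (xq;q)_∞) is then the polynomial ∏ n m.
  Q₂ Q₁ : ℕ → ℕ → Series
  Q₂ N m c = ∑ N (λ n → shift (ε m n) ([1+q^ 2 * m + 4 * n + 2 ] ∏ n m) c)
  Q₁ N m c = ∑ N (λ n → shift (ε m n + n) ([1+q^ m + 2 * n + 1 ] ∏ n m) c)

  shift-∏-suc : ∀ a n m c → shift a (∏ n (suc m)) c ≡ shift a (∏ n m) c xor shift (a + (m + n + 1)) (∏ n m) c
  shift-∏-suc a n m c = trans (shift-[1+q^] a (suc (n + m)) (∏ n m) c)
    (cong (λ e → shift a (∏ n m) c xor shift (a + e) (∏ n m) c) (arith n m))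
    where
    arith : ∀ n m → suc (n + m) ≡ m + n + 1
    arith = solve-∀

  shift-[1+q^]-at : ∀ a k {b} f c → a + k ≡ b → shift a ([1+q^ k ] f) c ≡ shift a f c xor shift b f c
  shift-[1+q^]-at a k f c refl = shift-[1+q^] a k f c

  -- This is 1 - q^0 = 0; it removes the term n = 0 before each of the two index shifts below.
  shift-[1+q^0] : ∀ a f c → shift a ([1+q^ 0 ] f) c ≡ false
  shift-[1+q^0] a f c = trans (shift-[1+q^] a 0 f c)
    (trans (cong (λ e → shift a f c xor shift e f c) (+-identityʳ a)) (xor-same (shift a f c)))

  -- Rogers' relation Q_{2,1}(x) = Q_{2,2}(xq). Write 1 - q^(m+2n+1) = (1 - q^n) + q^n (1 -
  -- q^(m+n+1)). The first summand extends `∏ n m` at the bottom, the second at the top, giving m+1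
  -- factors in both cases. Once the first sum is shifted by one index, the two products coincide
  -- and the terms recombine.
  Q₁≡Q₂ : ∀ N m {c} → c < N → Q₁ N m c ≡ Q₂ N (suc m) c
  Q₁≡Q₂ N m {c} c<N = begin
    Q₁ N m c
      ≡⟨ ∑-cong N (λ n _ → split n) ⟩
    ∑ N (λ n → A n xor B n)
      ≡⟨ ∑-xor N A B ⟩
    ∑ N A xor ∑ N B
      ≡⟨ cong (_xor ∑ N B) (∑-reindex N A (shift-[1+q^0] 0 (∏ 0 m) c)
           (shift-small _ _ (≤-trans c<N (m≤n+m N (ε m N))))) ⟩
    ∑ N (A ∘ suc) xor ∑ N B
      ≡⟨ sym (∑-xor N (A ∘ suc) B) ⟩
    ∑ N (λ n → A (suc n) xor B n)
      ≡⟨ ∑-cong N (λ n _ → join n) ⟩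
    Q₂ N (suc m) c ∎
    where
    open ≡-Reasoning
    open xor-∧-Solver
    A B : ℕ → Bool
    A n = shift (ε m n + n) ([1+q^ n ] ∏ n m) c
    B n = shift (ε m n + 2 * n) (∏ n (suc m)) c
    e₁ : ∀ e m n → e + n + (m + 2 * n + 1) ≡ e + 2 * n + (m + n + 1)
    e₁ = solve-∀
    e₂ : ∀ e n → e + n + n ≡ e + 2 * n
    e₂ = solve-∀
    e₃ : ∀ e m n → e + 2 * n + (2 * suc m + 4 * n + 2) ≡ e + (2 * m + 5 * n + 3) + suc n
    e₃ = solve-∀
    split : ∀ n → shift (ε m n + n) ([1+q^ m + 2 * n + 1 ] ∏ n m) c ≡ A n xor B n
    split n = begin
      shift (ε m n + n) ([1+q^ m + 2 * n + 1 ] ∏ n m) c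
        ≡⟨ shift-[1+q^]-at (ε m n + n) (m + 2 * n + 1) (∏ n m) c (e₁ (ε m n) m n) ⟩
      x xor z
        ≡⟨ solve 3 (λ x y z → x :+ z := (x :+ y) :+ (y :+ z)) refl x y z ⟩
      (x xor y) xor (y xor z)
        ≡⟨ sym (cong₂ _xor_ (shift-[1+q^]-at (ε m n + n) n (∏ n m) c (e₂ (ε m n) n)) (shift-∏-suc (ε m n + 2 * n) n m c)) ⟩
      A n xor B n ∎
      where
      x = shift (ε m n + n) (∏ n m) c
      y = shift (ε m n + 2 * n) (∏ n m) c
      z = shift (ε m n + 2 * n + (m + n + 1)) (∏ n m) c
    join : ∀ n → A (suc n) xor B n ≡ shift (ε (suc m) n) ([1+q^ 2 * suc m + 4 * n + 2 ] ∏ n (suc m)) c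
    join n = begin
      A (suc n) xor B n
        ≡⟨ cong (_xor B n) (sym (shift-cong-≗ (ε m (suc n) + suc n) (∏-unfoldˡ n m) c)) ⟩
      shift (ε m (suc n) + suc n) (∏ n (suc m)) c xor B n
        ≡⟨ solve 2 (λ x y → x :+ y := y :+ x) refl _ (B n) ⟩
      B n xor shift (ε m (suc n) + suc n) (∏ n (suc m)) c
        ≡⟨ sym (shift-[1+q^]-at (ε m n + 2 * n) (2 * suc m + 4 * n + 2) (∏ n (suc m)) c (e₃ (ε m n) m n)) ⟩
      shift (ε m n + 2 * n) ([1+q^ 2 * suc m + 4 * n + 2 ] ∏ n (suc m)) c
        ≡⟨ cong (λ e → shift e ([1+q^ 2 * suc m + 4 * n + 2 ] ∏ n (suc m)) c) (sym (ε-suc m n)) ⟩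
      shift (ε (suc m) n) ([1+q^ 2 * suc m + 4 * n + 2 ] ∏ n (suc m)) c ∎

  -- Rogers' relation Q_{2,2}(x) - Q_{2,1}(x) = xq Q_{2,1}(xq), by the same method. The splitting is
  -- now (1 - q^(2m+4n+2)) - q^n (1 - q^(m+2n+1)) = (1 - q^n) + q^(m+3n+1) (1 - q^(m+n+1)).
  Q₂≡Q₁+Q₁ : ∀ N m {c} → c < N → Q₂ N m c ≡ Q₁ N m c xor shift (suc m) (Q₁ N (suc m)) c
  Q₂≡Q₁+Q₁ N m {c} c<N = begin
    Q₂ N m c
      ≡⟨ solve 2 (λ x y → x := y :+ (x :+ y)) refl (Q₂ N m c) (Q₁ N m c) ⟩
    Q₁ N m c xor (Q₂ N m c xor Q₁ N m c)
      ≡⟨ cong (Q₁ N m c xor_) (begin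
        Q₂ N m c xor Q₁ N m c
          ≡⟨ sym (∑-xor N q₂ q₁) ⟩
        ∑ N (λ n → q₂ n xor q₁ n)
          ≡⟨ ∑-cong N (λ n _ → split n) ⟩
        ∑ N (λ n → A n xor B n)
          ≡⟨ ∑-xor N A B ⟩
        ∑ N A xor ∑ N B
          ≡⟨ cong (_xor ∑ N B) (∑-reindex N A (shift-[1+q^0] 0 (∏ 0 m) c)
               (shift-small _ _ (≤-trans c<N (n≤ε m N)))) ⟩
        ∑ N (A ∘ suc) xor ∑ N B
          ≡⟨ sym (∑-xor N (A ∘ suc) B) ⟩
        ∑ N (λ n → A (suc n) xor B n)
          ≡⟨ ∑-cong N (λ n _ → join n) ⟩
        ∑ N (λ n → shift (suc m) (shift (ε (suc m) n + n) ([1+q^ suc m + 2 * n + 1 ] ∏ n (suc m))) c)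
          ≡⟨ sym (shift-∑ (suc m) N (λ n → shift (ε (suc m) n + n) ([1+q^ suc m + 2 * n + 1 ] ∏ n (suc m))) c) ⟩
        shift (suc m) (Q₁ N (suc m)) c ∎) ⟩
    Q₁ N m c xor shift (suc m) (Q₁ N (suc m)) c ∎
    where
    open ≡-Reasoning
    open xor-∧-Solver
    q₁ q₂ A B : ℕ → Bool
    q₂ n = shift (ε m n) ([1+q^ 2 * m + 4 * n + 2 ] ∏ n m) c
    q₁ n = shift (ε m n + n) ([1+q^ m + 2 * n + 1 ] ∏ n m) c
    A n = shift (ε m n) ([1+q^ n ] ∏ n m) c
    B n = shift (ε m n + (m + 3 * n + 1)) (∏ n (suc m)) c
    e₁ : ∀ e m n → e + n + (m + 2 * n + 1) ≡ e + (m + 3 * n + 1)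
    e₁ = solve-∀
    e₂ : ∀ e m n → e + (2 * m + 4 * n + 2) ≡ e + (m + 3 * n + 1) + (m + n + 1)
    e₂ = solve-∀
    e₃ : ∀ e m n → e + (m + 3 * n + 1) + (suc m + 2 * n + 1) ≡ e + (2 * m + 5 * n + 3)
    e₃ = solve-∀
    e₄ : ∀ e m n → e + (m + 3 * n + 1) ≡ suc m + (e + 2 * n + n)
    e₄ = solve-∀
    split : ∀ n → q₂ n xor q₁ n ≡ A n xor B n
    split n = begin
      q₂ n xor q₁ n
        ≡⟨ cong₂ _xor_ (shift-[1+q^]-at (ε m n) (2 * m + 4 * n + 2) (∏ n m) c (e₂ (ε m n) m n))
                       (shift-[1+q^]-at (ε m n + n) (m + 2 * n + 1) (∏ n m) c (e₁ (ε m n) m n)) ⟩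
      (w xor z) xor (x xor y)
        ≡⟨ solve 4 (λ w x y z → (w :+ z) :+ (x :+ y) := (w :+ x) :+ (y :+ z)) refl w x y z ⟩
      (w xor x) xor (y xor z)
        ≡⟨ sym (cong₂ _xor_ (shift-[1+q^] (ε m n) n (∏ n m) c) (shift-∏-suc (ε m n + (m + 3 * n + 1)) n m c)) ⟩
      A n xor B n ∎
      where
      w = shift (ε m n) (∏ n m) c
      x = shift (ε m n + n) (∏ n m) c
      y = shift (ε m n + (m + 3 * n + 1)) (∏ n m) c
      z = shift (ε m n + (m + 3 * n + 1) + (m + n + 1)) (∏ n m) c
    join : ∀ n → A (suc n) xor B n ≡
      shift (suc m) (shift (ε (suc m) n + n) ([1+q^ suc m + 2 * n + 1 ] ∏ n (suc m))) c
    join n = begin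
      A (suc n) xor B n
        ≡⟨ cong (_xor B n) (sym (shift-cong-≗ (ε m (suc n)) (∏-unfoldˡ n m) c)) ⟩
      shift (ε m (suc n)) (∏ n (suc m)) c xor B n
        ≡⟨ solve 2 (λ x y → x :+ y := y :+ x) refl _ (B n) ⟩
      B n xor shift (ε m (suc n)) (∏ n (suc m)) c
        ≡⟨ sym (shift-[1+q^]-at (ε m n + (m + 3 * n + 1)) (suc m + 2 * n + 1) (∏ n (suc m)) c (e₃ (ε m n) m n)) ⟩
      shift (ε m n + (m + 3 * n + 1)) g c
        ≡⟨ cong (λ e → shift e g c) (trans (e₄ (ε m n) m n) (cong (λ e → suc m + (e + n)) (sym (ε-suc m n)))) ⟩
      shift (suc m + (ε (suc m) n + n)) g c
        ≡⟨ shift-+ (suc m) (ε (suc m) n + n) g c ⟩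
      shift (suc m) (shift (ε (suc m) n + n) g) c ∎
      where g = [1+q^ suc m + 2 * n + 1 ] ∏ n (suc m)

  -- Eliminates `Q₁`: each of its two occurrences is `Q₂` with the parameter raised by one.
  Q₂-rec : ∀ N m {c} → c < N → Q₂ N m c ≡ Q₂ N (suc m) c xor shift (suc m) (Q₂ N (2 + m)) c
  Q₂-rec N m {c} c<N = trans (Q₂≡Q₁+Q₁ N m c<N)
    (cong₂ _xor_ (Q₁≡Q₂ N m c<N)
      (shift-cong (suc m) c (λ d d≤c → Q₁≡Q₂ N (suc m) (≤-trans (s≤s d≤c) c<N))))

  m<ε : ∀ m n → m < ε m (suc n)
  m<ε m n = ≤-trans (subst (suc m ≤_) (arith m n) (m≤m+n (suc m) _)) (m≤n+m (2 * m + 5 * n + 3) (ε m n))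
    where
    arith : ∀ m n → suc m + (m + 5 * n + 2) ≡ 2 * m + 5 * n + 3
    arith = solve-∀

  -- The terms with n ≥ 1 start beyond q^m, and so does the second half q^(2m+2) of the term n = 0.
  -- What survives has m factors instead of L, a difference that `∏-stable` absorbs.
  Q₂-limit : ∀ N m {c} → c ≤ m → Q₂ (suc N) m c ≡ ∏ 0 m c
  Q₂-limit N m {c} c≤m = trans
    (∑-single (suc N) (λ n → shift (ε m n) ([1+q^ 2 * m + 4 * n + 2 ] ∏ n m) c) 0 (s≤s z≤n)
      λ { zero k≢0 → contradiction refl k≢0
        ; (suc n) _ → shift-small _ ([1+q^ 2 * m + 4 * suc n + 2 ] ∏ (suc n) m) (≤-trans (s≤s c≤m) (m<ε m n)) })
    (trans (cong (∏ 0 m c xor_) (shift-small _ (∏ 0 m) (subst (suc c ≤_) (arith m) (≤-trans (s≤s c≤m) (m≤m+n (suc m) (m + 1))))))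
           (xor-identityʳ _))
    where
    arith : ∀ m → suc m + (m + 1) ≡ 2 * m + 0 + 2
    arith = solve-∀

  -- Both sides satisfy g(m) = g(m+1) + q^(m+1) g(m+2), and both agree with
  -- (q;q)_∞ up to q^m: downward induction on m.
  sumSide≡Q₂ : ∀ L d m {c} → c ≤ d + m → c ≤ L → sumSide L m c ≡ Q₂ (suc L) m c
  sumSide≡Q₂ L zero m c≤m c≤L = trans (sumSide-limit L m c≤m)
    (trans (∏-stable 0 c≤L c≤m) (sym (Q₂-limit L m c≤m)))
  sumSide≡Q₂ L (suc d) m {c} c≤ c≤L = begin
    sumSide L m c
      ≡⟨ sumSide-rec L m c≤L ⟩
    sumSide L (suc m) c xor shift (suc m) (sumSide L (2 + m)) c
      ≡⟨ cong₂ _xor_ (sumSide≡Q₂ L d (suc m) c≤′ c≤L)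
           (shift-cong (suc m) c (λ b b≤c → sumSide≡Q₂ L d (2 + m)
             (≤-trans b≤c (≤-trans c≤′ (+-monoʳ-≤ d (n≤1+n (suc m))))) (≤-trans b≤c c≤L))) ⟩
    Q₂ (suc L) (suc m) c xor shift (suc m) (Q₂ (suc L) (2 + m)) c
      ≡⟨ sym (Q₂-rec (suc L) m (s≤s c≤L)) ⟩
    Q₂ (suc L) m c ∎
    where
    open ≡-Reasoning
    c≤′ : c ≤ d + suc m
    c≤′ = subst (c ≤_) (sym (+-suc d m)) c≤

-- Partition counts modulo 2 as coefficients of products.

module CountingModTwo where

  open import Data.Nat using (_+_; _*_)
  open RogersRamanujan

  oddly : ∀ {A : Set} → (A → Bool) → List A → Bool
  oddly f []       = false
  oddly f (x ∷ xs) = f x xor oddly f xs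

  module _ {A : Set} where

    oddly-++ : ∀ (f : A → Bool) xs ys → oddly f (xs ++ ys) ≡ oddly f xs xor oddly f ys
    oddly-++ f []       ys = refl
    oddly-++ f (x ∷ xs) ys = trans (cong (f x xor_) (oddly-++ f xs ys)) (sym (xor-assoc (f x) _ _))

    oddly-map : ∀ {B : Set} (f : A → Bool) (g : B → A) xs → oddly f (map g xs) ≡ oddly (f ∘ g) xs
    oddly-map f g []       = refl
    oddly-map f g (x ∷ xs) = cong (f (g x) xor_) (oddly-map f g xs)

    oddly-cong : ∀ {f g : A → Bool} {xs} → All (λ x → f x ≡ g x) xs → oddly f xs ≡ oddly g xs
    oddly-cong []           = refl
    oddly-cong (fx≡gx ∷ ps) = cong₂ _xor_ fx≡gx (oddly-cong ps)

    oddly-false : ∀ {f : A → Bool} xs → (∀ x → f x ≡ false) → oddly f xs ≡ false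
    oddly-false []       f≡0 = refl
    oddly-false (x ∷ xs) f≡0 = cong₂ _xor_ (f≡0 x) (oddly-false xs f≡0)

    oddly-xor : ∀ (f g : A → Bool) xs → oddly (λ x → f x xor g x) xs ≡ oddly f xs xor oddly g xs
    oddly-xor f g []       = refl
    oddly-xor f g (x ∷ xs) = trans (cong ((f x xor g x) xor_) (oddly-xor f g xs))
      (solve 4 (λ a b c d → (a :+ b) :+ (c :+ d) := (a :+ c) :+ (b :+ d)) refl
         (f x) (g x) (oddly f xs) (oddly g xs))
      where open xor-∧-Solver

    oddly-∑ : ∀ n (F : ℕ → A → Bool) xs →
      oddly (λ x → ∑ n (λ i → F i x)) xs ≡ ∑ n (λ i → oddly (F i) xs)
    oddly-∑ zero    F xs = oddly-false xs (λ _ → refl)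
    oddly-∑ (suc n) F xs = trans (oddly-xor (F 0) (λ x → ∑ n (λ i → F (suc i) x)) xs)
      (cong (oddly (F 0) xs xor_) (oddly-∑ n (F ∘ suc) xs))

  bit : Bool → ℕ
  bit false = 0
  bit true  = 1

  suc-%2 : ∀ k b → k % 2 ≡ bit b → suc k % 2 ≡ bit (not b)
  suc-%2 zero          false eq = refl
  suc-%2 (suc zero)    true  eq = refl
  suc-%2 (suc (suc k)) b     eq = suc-%2 k b eq

  length-filter-%2 : ∀ {A : Set} {P : A → Set} (P? : Decidable P) xs →
    length (filter P? xs) % 2 ≡ bit (oddly (does ∘ P?) xs)
  length-filter-%2 P? [] = refl
  length-filter-%2 P? (x ∷ xs) with does (P? x)
  ... | true  = suc-%2 (length (filter P? xs)) _ (length-filter-%2 P? xs)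
  ... | false = length-filter-%2 P? xs

  -- The list is ordered by first part, so raising the bound appends exactly the partitions whose
  -- largest part is the new bound. This is the combinatorial counterpart of adjoining a top factor
  -- to `∏`.
  partsAux-suc : ∀ k n m → m ≤ n →
    partsAux (suc k) (suc n) (suc m) ≡
    partsAux (suc k) (suc n) m ++ map (suc m ∷_) (partsAux k (n ∸ m) (suc m))
  partsAux-suc k n m m≤n = begin
    concatMap extend (filter (_≤? suc n) (applyUpTo suc (suc m)))
      ≡⟨ cong (concatMap extend ∘ filter (_≤? suc n)) (sym (applyUpTo-∷ʳ suc m)) ⟩
    concatMap extend (filter (_≤? suc n) (applyUpTo suc m ∷ʳ suc m))
      ≡⟨ cong (concatMap extend) (filter-++ (_≤? suc n) (applyUpTo suc m) (suc m ∷ [])) ⟩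
    concatMap extend (filter (_≤? suc n) (applyUpTo suc m) ++ filter (_≤? suc n) (suc m ∷ []))
      ≡⟨ cong (λ ps → concatMap extend (filter (_≤? suc n) (applyUpTo suc m) ++ ps))
              (filter-all (_≤? suc n) (s≤s m≤n ∷ [])) ⟩
    concatMap extend (filter (_≤? suc n) (applyUpTo suc m) ++ suc m ∷ [])
      ≡⟨ concatMap-++ extend (filter (_≤? suc n) (applyUpTo suc m)) (suc m ∷ []) ⟩
    partsAux (suc k) (suc n) m ++ extend (suc m) ++ []
      ≡⟨ cong (partsAux (suc k) (suc n) m ++_) (++-identityʳ (extend (suc m))) ⟩
    partsAux (suc k) (suc n) m ++ extend (suc m) ∎
    where
    open ≡-Reasoning
    extend : ℕ → List (List ℕ)
    extend p = map (p ∷_) (partsAux k (suc n ∸ p) p)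

  partsAux-suc-> : ∀ k n m → n < m → partsAux (suc k) (suc n) (suc m) ≡ partsAux (suc k) (suc n) m
  partsAux-suc-> k n m n<m = cong (concatMap (λ p → map (p ∷_) (partsAux k (suc n ∸ p) p))) (begin
    filter (_≤? suc n) (applyUpTo suc (suc m))
      ≡⟨ cong (filter (_≤? suc n)) (sym (applyUpTo-∷ʳ suc m)) ⟩
    filter (_≤? suc n) (applyUpTo suc m ∷ʳ suc m)
      ≡⟨ filter-++ (_≤? suc n) (applyUpTo suc m) (suc m ∷ []) ⟩
    filter (_≤? suc n) (applyUpTo suc m) ++ filter (_≤? suc n) (suc m ∷ [])
      ≡⟨ cong (filter (_≤? suc n) (applyUpTo suc m) ++_)
              (filter-none (_≤? suc n) ((<⇒≱ (s≤s n<m)) ∷ [])) ⟩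
    filter (_≤? suc n) (applyUpTo suc m) ++ []
      ≡⟨ ++-identityʳ _ ⟩
    filter (_≤? suc n) (applyUpTo suc m) ∎)
    where
    open ≡-Reasoning

  partsAux-bounds : ∀ k n m → All (All (λ p → 0 < p × p ≤ m)) (partsAux k n m)
  partsAux-bounds k       zero    m    = [] ∷ []
  partsAux-bounds zero    (suc n) m    = []
  partsAux-bounds (suc k) (suc n) zero = []
  partsAux-bounds (suc k) (suc n) (suc m) with m ≤? n
  ... | yes m≤n = subst (All _) (sym (partsAux-suc k n m m≤n))
    (All.++⁺ (All.map (All.map (λ (0<p , p≤m) → 0<p , m≤n⇒m≤1+n p≤m)) (partsAux-bounds (suc k) (suc n) m))
             (All.map⁺ (All.map ((s≤s z≤n , ≤-refl) ∷_) (partsAux-bounds k (n ∸ m) (suc m)))))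
  ... | no m≰n = subst (All _) (sym (partsAux-suc-> k n m (≰⇒> m≰n)))
    (All.map (All.map (λ (0<p , p≤m) → 0<p , m≤n⇒m≤1+n p≤m)) (partsAux-bounds (suc k) (suc n) m))

  -- One family for both conditions: on positive parts (a) is the case a = 1, t = 0, and (b) for a
  -- given j ≥ 2 is the case a = j, t = j².
  DistinctAbove : ℕ → ℕ → List ℕ → Set
  DistinctAbove a t λs = ones λs ≡ t × Unique (big λs) × All (suc a ≤_) (big λs)

  distinctAbove? : ∀ a t λs → Dec (DistinctAbove a t λs)
  distinctAbove? a t λs = (ones λs ≟ t) ×-dec (uniq? (big λs) ×-dec All.all? (suc a ≤?_) (big λs))

  distinctAbove : ℕ → ℕ → List ℕ → Bool
  distinctAbove a t λs = does (distinctAbove? a t λs)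

  module _ (a t : ℕ) where

    distinctAbove-drop : ∀ {m xs} → a ≤ suc m → All (λ p → 0 < p × p ≤ suc m) xs →
      distinctAbove a t (2 + m ∷ xs) ≡ distinctAbove a t xs
    distinctAbove-drop {m} {xs} a≤m xs≤m = does-⇔
      (mk⇔ (λ { (o , (_ ∷ u) , (_ ∷ l)) → o , u , l })
           (λ { (o , u , l) → o , (All.map (λ { (_ , p≤m) refl → <-irrefl refl p≤m })
                                     (All.filter⁺ (1 <?_) xs≤m) ∷ u) , (s≤s a≤m ∷ l) }))
      (distinctAbove? a t (2 + m ∷ xs)) (distinctAbove? a t xs)

    distinctAbove-small : ∀ {m} xs → 2 + m ≤ a → distinctAbove a t (2 + m ∷ xs) ≡ false
    distinctAbove-small {m} xs m≤a = dec-false (distinctAbove? a t (2 + m ∷ xs))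
      λ { (_ , _ , (a<m ∷ _)) → <-irrefl refl (≤-trans a<m m≤a) }

    distinctAbove-repeat : ∀ m xs → distinctAbove a t (2 + m ∷ 2 + m ∷ xs) ≡ false
    distinctAbove-repeat m xs = dec-false (distinctAbove? a t (2 + m ∷ 2 + m ∷ xs))
      λ { (_ , ((≢ ∷ _) ∷ _) , _) → ≢ refl }

    countMod2 : ℕ → ℕ → ℕ → Bool
    countMod2 k n m = oddly (distinctAbove a t) (partsAux k n m)

    countMod2-head : ∀ k n m → a ≤ suc m →
      oddly (distinctAbove a t ∘ (2 + m ∷_)) (partsAux k n (2 + m)) ≡ countMod2 k n (suc m)
    countMod2-head k zero m a≤ = cong (_xor false) (distinctAbove-drop a≤ [])
    countMod2-head zero (suc n) m a≤ = refl
    countMod2-head (suc k) (suc n) m a≤ with suc m ≤? n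
    ... | yes m≤n = begin
      oddly f (partsAux (suc k) (suc n) (2 + m))
        ≡⟨ cong (oddly f) (partsAux-suc k n (suc m) m≤n) ⟩
      oddly f (partsAux (suc k) (suc n) (suc m) ++ map (2 + m ∷_) rest)
        ≡⟨ oddly-++ f (partsAux (suc k) (suc n) (suc m)) _ ⟩
      oddly f (partsAux (suc k) (suc n) (suc m)) xor oddly f (map (2 + m ∷_) rest)
        ≡⟨ cong₂ _xor_ (oddly-cong (All.map (distinctAbove-drop a≤) (partsAux-bounds (suc k) (suc n) (suc m))))
             (trans (oddly-map f (2 + m ∷_) rest) (oddly-false rest (distinctAbove-repeat m))) ⟩
      countMod2 (suc k) (suc n) (suc m) xor false
        ≡⟨ xor-identityʳ _ ⟩
      countMod2 (suc k) (suc n) (suc m) ∎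
      where
      open ≡-Reasoning
      f = distinctAbove a t ∘ (2 + m ∷_)
      rest = partsAux k (n ∸ suc m) (2 + m)
    ... | no m≰n = trans (cong (oddly _) (partsAux-suc-> k n (suc m) (≰⇒> m≰n)))
      (oddly-cong (All.map (distinctAbove-drop a≤) (partsAux-bounds (suc k) (suc n) (suc m))))

    countMod2-suc : ∀ k n m → suc m ≤ n →
      countMod2 (suc k) (suc n) (2 + m) ≡
      countMod2 (suc k) (suc n) (suc m) xor
      oddly (distinctAbove a t ∘ (2 + m ∷_)) (partsAux k (n ∸ suc m) (2 + m))
    countMod2-suc k n m m≤n = trans (cong (oddly (distinctAbove a t)) (partsAux-suc k n (suc m) m≤n))
      (trans (oddly-++ (distinctAbove a t) (partsAux (suc k) (suc n) (suc m)) _)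
        (cong (countMod2 (suc k) (suc n) (suc m) xor_) (oddly-map (distinctAbove a t) (2 + m ∷_) (partsAux k (n ∸ suc m) (2 + m)))))

    countMod2-suc-> : ∀ k n m → n < suc m → countMod2 (suc k) (suc n) (2 + m) ≡ countMod2 (suc k) (suc n) (suc m)
    countMod2-suc-> k n m n<m = cong (oddly (distinctAbove a t)) (partsAux-suc-> k n (suc m) n<m)

  -- With bound 1 the only partition of n consists of n ones, so t must equal n. Here and below
  -- `n ≤ k` says that the fuel suffices.
  countMod2-ones : ∀ a t k n → n ≤ k → countMod2 a t k n 1 ≡ shift t δ n
  countMod2-ones a zero    k zero    _ = cong (_xor false) (dec-true (distinctAbove? a 0 []) (refl , [] , []))
  countMod2-ones a (suc t) k zero    _ = refl
  countMod2-ones a zero    (suc k) (suc n) (s≤s n≤k) = trans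
    (cong (oddly (distinctAbove a 0)) (++-identityʳ (map (1 ∷_) (partsAux k n 1))))
    (trans (oddly-map (distinctAbove a 0) (1 ∷_) (partsAux k n 1))
      (oddly-false (partsAux k n 1) (λ _ → refl)))
  countMod2-ones a (suc t) (suc k) (suc n) (s≤s n≤k) = trans
    (cong (oddly (distinctAbove a (suc t))) (++-identityʳ (map (1 ∷_) (partsAux k n 1))))
    (trans (oddly-map (distinctAbove a (suc t)) (1 ∷_) (partsAux k n 1))
      (trans (oddly-cong (All.universal dropOne (partsAux k n 1))) (countMod2-ones a t k n n≤k)))
    where
    dropOne : ∀ xs → distinctAbove a (suc t) (1 ∷ xs) ≡ distinctAbove a t xs
    dropOne xs = does-⇔ (mk⇔ (λ (o , r) → suc-injective o , r) (λ (o , r) → cong suc o , r))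
      (distinctAbove? a (suc t) (1 ∷ xs)) (distinctAbove? a t xs)

  -- Parts from 2 to a are forbidden, so raising the bound from 1 up to a adds no admissible
  -- partition.
  countMod2-small : ∀ a t m k n → suc m ≤ a → n ≤ k → countMod2 a t k n (suc m) ≡ shift t δ n
  countMod2-small a t zero    k n _ n≤k = countMod2-ones a t k n n≤k
  countMod2-small a t (suc m) k zero m≤a n≤k = countMod2-small a t m k 0 (<⇒≤ m≤a) n≤k
  countMod2-small a t (suc m) (suc k) (suc n) m≤a n≤k with suc m ≤? n
  ... | yes m≤n = trans (countMod2-suc a t k n m m≤n) (trans
    (cong₂ _xor_ (countMod2-small a t m (suc k) (suc n) (<⇒≤ m≤a) n≤k)
       (oddly-false (partsAux k (n ∸ suc m) (2 + m)) (λ xs → distinctAbove-small a t xs m≤a)))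
    (xor-identityʳ _))
  ... | no m≰n = trans (countMod2-suc-> a t k n m (≰⇒> m≰n)) (countMod2-small a t m (suc k) (suc n) (<⇒≤ m≤a) n≤k)

  -- Each size p above the threshold is absent or used once, so admitting it multiplies the series
  -- by 1 + q^p, while the ones contribute q^t. The threshold is a successor so that the part 1 is
  -- always within the bound.
  countMod2≡∏ : ∀ a t d k n → n ≤ k → countMod2 (suc a) t k n (suc a + d) ≡ shift t (∏ (suc a) d) n
  countMod2≡∏ a t zero k n n≤k = trans (cong (countMod2 (suc a) t k n ∘ suc) (+-identityʳ a))
    (countMod2-small (suc a) t a k n ≤-refl n≤k)
  countMod2≡∏ a t (suc d) k n n≤k = begin
    countMod2 (suc a) t k n (suc a + suc d)
      ≡⟨ cong (countMod2 (suc a) t k n ∘ suc) (+-suc a d) ⟩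
    countMod2 (suc a) t k n (2 + (a + d))
      ≡⟨ step k n n≤k ⟩
    shift t p n xor shift (suc m) (shift t p) n
      ≡⟨ cong (shift t p n xor_) (trans (sym (shift-+ (suc m) t p n)) (cong (λ e → shift e p n) (+-comm (suc m) t))) ⟩
    shift t p n xor shift (t + suc m) p n
      ≡⟨ sym (shift-[1+q^] t (suc m) p n) ⟩
    shift t (∏ (suc a) (suc d)) n ∎
    where
    open ≡-Reasoning
    m = suc (a + d)
    p = ∏ (suc a) d
    step : ∀ k n → n ≤ k → countMod2 (suc a) t k n (suc m) ≡ shift t p n xor shift (suc m) (shift t p) n
    step k zero n≤k = trans (countMod2≡∏ a t d k 0 n≤k) (sym (xor-identityʳ _))
    step (suc k) (suc n) n≤k with m ≤? n
    ... | yes m≤n = trans (countMod2-suc (suc a) t k n (a + d) m≤n)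
      (cong₂ _xor_ (countMod2≡∏ a t d (suc k) (suc n) n≤k)
        (trans (countMod2-head (suc a) t k (n ∸ m) (a + d) (s≤s (m≤m+n a d)))
        (trans (countMod2≡∏ a t d k (n ∸ m) (≤-trans (m∸n≤m n m) (≤-pred n≤k)))
        -- Removing the part m+1 from a partition of n+1 leaves n - m, whose coefficient is the one
        -- at n+1 after a shift by m+1.
        (trans (sym (shift-exact (suc m) (shift t p) (n ∸ m)))
          (cong (shift (suc m) (shift t p) ∘ suc) (m+[n∸m]≡n m≤n))))))
    ... | no m≰n = trans (countMod2-suc-> (suc a) t k n (a + d) (≰⇒> m≰n))
      (trans (countMod2≡∏ a t d (suc k) (suc n) n≤k)
        (trans (sym (xor-identityʳ _)) (cong (shift t p (suc n) xor_)
          (sym (shift-small (suc m) (shift t p) (s≤s (≰⇒> m≰n)))))))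

  -- Conditions (a) and (b) as a sum modulo 2.

  ones≡0 : ∀ {xs} → All (1 <_) xs → ones xs ≡ 0
  ones≡0 []                       = refl
  ones≡0 (s≤s (s≤s z≤n) ∷ 1<xs) = ones≡0 1<xs

  ones≡0⇒1< : ∀ {m xs} → All (λ p → 0 < p × p ≤ m) xs → ones xs ≡ 0 → All (1 <_) xs
  ones≡0⇒1< []                                   _  = []
  ones≡0⇒1< {xs = suc (suc _) ∷ _} (_ ∷ ps) o≡0 = s≤s (s≤s z≤n) ∷ ones≡0⇒1< ps o≡0

  -- Positivity of the parts turns the absence of ones into all parts being greater than 1, and then
  -- `big` changes nothing.
  condA-distinctAbove : ∀ {m xs} → All (λ p → 0 < p × p ≤ m) xs → does (condA? xs) ≡ distinctAbove 1 0 xs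
  condA-distinctAbove {xs = xs} ps = does-⇔ (mk⇔
    (λ (u , l) → ones≡0 l , subst Unique (sym (filter-all (1 <?_) l)) u , subst (All _) (sym (filter-all (1 <?_) l)) l)
    (λ (o , u , _) → let l = ones≡0⇒1< ps o in subst Unique (filter-all (1 <?_) l) u , l))
    (condA? xs) (distinctAbove? 1 0 xs)

  -- With at most one witness, the disjunction is a sum modulo 2. The enumeration `f` is general so
  -- that the induction can pass to `f ∘ suc`.
  any?-upTo : ∀ {P : ℕ → Set} (P? : Decidable P) (f : ℕ → ℕ) n →
    (∀ i k → P (f i) → P (f k) → i ≡ k) →
    does (any? P? (applyUpTo f n)) ≡ ∑ n (does ∘ P? ∘ f)
  any?-upTo P? f zero    unique = refl
  any?-upTo P? f (suc n) unique with P? (f 0)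
  ... | yes p = cong not (sym (∑-false n (λ i _ → dec-false (P? (f (suc i))) (λ q → 0≢1+n (unique 0 (suc i) p q)))))
  ... | no ¬p = any?-upTo P? (f ∘ suc) n (λ i k p q → suc-injective (unique (suc i) (suc k) p q))

  condBj-unique : ∀ λs i k → condBj λs i → condBj λs k → i ≡ k
  condBj-unique λs i k (_ , oi , _) (_ , ok , _) with <-cmp i k
  ... | tri< i<k _ _ = contradiction (trans (sym oi) ok) (<⇒≢ (*-mono-< i<k i<k))
  ... | tri≈ _ i≡k _ = i≡k
  ... | tri> _ _ k<i = contradiction (trans (sym ok) oi) (<⇒≢ (*-mono-< k<i k<i))

  does-⊎-disjoint : ∀ {A B : Set} (a? : Dec A) (b? : Dec B) → (A → ¬ B) →
    does (a? ⊎-dec b?) ≡ does a? xor does b?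
  does-⊎-disjoint (no _)  b? disjoint = refl
  does-⊎-disjoint (yes a) b? disjoint = cong not (sym (dec-false b? (disjoint a)))

  condA⇒¬condB : ∀ n λs → condA λs → ¬ condB n λs
  condA⇒¬condB n λs (_ , 1<λs) b with satisfied b
  ... | suc j , _ , ones≡j² , _ = 0≢1+n (trans (sym (ones≡0 1<λs)) ones≡j²)

  -- All the cases exclude one another: (a) allows no ones, (b) requires j² > 0 of them, and this
  -- number determines j.
  c9?-xor : ∀ n λs → does (c9? n λs) ≡ does (condA? λs) xor ∑ (suc n) (λ j → does (condBj? λs j))
  c9?-xor n λs = trans (does-⊎-disjoint (condA? λs) (condB? n λs) (condA⇒¬condB n λs))
    (cong (does (condA? λs) xor_) (any?-upTo (condBj? λs) (λ i → i) (suc n) (condBj-unique λs)))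

  c9-sumSide : ∀ n → c9 n % 2 ≡ bit (sumSide n 0 n)
  -- Treated apart, since for n ≥ 1 the sum over j ≤ n contains both exceptional terms j = 0 and j =
  -- 1.
  c9-sumSide zero = refl
  c9-sumSide n@(suc n′) = trans (length-filter-%2 (c9? n) (partitions n)) (cong bit (begin
    oddly (does ∘ c9? n) (partitions n)
      ≡⟨ oddly-cong (All.universal (c9?-xor n) (partitions n)) ⟩
    oddly (λ λs → does (condA? λs) xor ∑ (suc n) (λ j → does (condBj? λs j))) (partitions n)
      ≡⟨ oddly-xor (does ∘ condA?) _ (partitions n) ⟩
    oddly (does ∘ condA?) (partitions n) xor
    oddly (λ λs → ∑ (suc n) (λ j → does (condBj? λs j))) (partitions n)
      ≡⟨ cong₂ _xor_
           (trans (oddly-cong (All.map condA-distinctAbove (partsAux-bounds n n n)))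
                  (countMod2≡∏ 0 0 n′ n n ≤-refl))
           (trans (oddly-∑ (suc n) (λ j λs → does (condBj? λs j)) (partitions n))
             -- For j = 0 and j = 1 the test 2 ≤ j computes to false, so both counts vanish.
             (cong₂ (λ x y → x xor (y xor ∑ n′ (λ i → oddly (λ λs → does (condBj? λs (2 + i))) (partitions n))))
               (oddly-false (partitions n) (λ _ → refl)) (oddly-false (partitions n) (λ _ → refl)))) ⟩
    ∏ 1 n′ n xor ∑ n′ (λ i → oddly (λ λs → does (condBj? λs (2 + i))) (partitions n))
      ≡⟨ cong₂ _xor_ firstTwo (∑-cong n′ rest) ⟩
    (∏ 0 n n xor shift 1 (∏ 1 n′) n) xor ∑ n′ (λ i → term (2 + i))
      ≡⟨ xor-assoc (∏ 0 n n) (shift 1 (∏ 1 n′) n) _ ⟩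
    sumSide n 0 n ∎))
    where
    open ≡-Reasoning
    open xor-∧-Solver
    term : ℕ → Bool
    term j = shift (j * j + 0 * j) (∏ j (n ∸ j)) n
    firstTwo : ∏ 1 n′ n ≡ ∏ 0 n n xor shift 1 (∏ 1 n′) n
    firstTwo = trans
      (solve 2 (λ x y → x := (x :+ y) :+ y) refl (∏ 1 n′ n) (shift 1 (∏ 1 n′) n))
      (cong (_xor shift 1 (∏ 1 n′) n) (sym (∏-unfoldˡ 0 n′ n)))
    rest : ∀ i → i < n′ → oddly (λ λs → does (condBj? λs (2 + i))) (partitions n) ≡ term (2 + i)
    rest i i<n′ = begin
      -- For j = 2 + i the test 2 ≤ j computes to true, so `condBj?` has the same truth value as
      -- `distinctAbove?` by computation.
      countMod2 j (j * j) n n n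
        ≡⟨ cong (countMod2 j (j * j) n n) (sym (m+[n∸m]≡n (s≤s i<n′))) ⟩
      countMod2 j (j * j) n n (j + (n ∸ j))
        ≡⟨ countMod2≡∏ (suc i) (j * j) (n ∸ j) n n ≤-refl ⟩
      shift (j * j) (∏ j (n ∸ j)) n
        ≡⟨ cong (λ e → shift e (∏ j (n ∸ j)) n) (sym (+-identityʳ (j * j))) ⟩
      term j ∎
      where j = 2 + i

-- The exponents (5j² + j)/2.

module PentagonalExponents where

  open import Data.Nat using (_+_; _*_)
  open import Data.Integer using (ℤ; +_; -[1+_])
  open RogersRamanujan
  open CountingModTwo

  shift-δ : ∀ a → shift a δ a ≡ true
  shift-δ zero    = refl
  shift-δ (suc a) = shift-δ a

  shift-δ-≢ : ∀ a c → c ≢ a → shift a δ c ≡ false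
  shift-δ-≢ zero    zero    c≢a = contradiction refl c≢a
  shift-δ-≢ zero    (suc c) c≢a = refl
  shift-δ-≢ (suc a) zero    c≢a = refl
  shift-δ-≢ (suc a) (suc c) c≢a = shift-δ-≢ a c (c≢a ∘ cong suc)

  -- pent j = (5j² + j)/2
  pent : ℤ → ℕ
  pent (+ i)    = ε 0 i
  pent -[1+ i ] = ε 0 i + (4 * i + 2)

  double-ε : ∀ i → 2 * ε 0 i ≡ 5 * i * i + i
  double-ε zero    = refl
  double-ε (suc i) = trans (*-distribˡ-+ 2 (ε 0 i) (5 * i + 3))
    (trans (cong (_+ 2 * (5 * i + 3)) (double-ε i)) (arith i))
    where
    arith : ∀ i → 5 * i * i + i + 2 * (5 * i + 3) ≡ 5 * suc i * suc i + suc i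
    arith = solve-∀

  -- For j = -(i+1) the value 5j² + j exceeds 5i² + i by 2(4i+2), which reduces the negative case to
  -- the nonnegative one.
  double-pent : ∀ j → + 2 ℤ.* + pent j ≡ + 5 ℤ.* j ℤ.* j ℤ.+ j
  double-pent (+ i) = begin
    + 2 ℤ.* + ε 0 i             ≡⟨ sym (ℤ.pos-* 2 (ε 0 i)) ⟩
    + (2 * ε 0 i)               ≡⟨ cong +_ (double-ε i) ⟩
    + (5 * i * i) ℤ.+ + i       ≡⟨ cong (ℤ._+ + i) (ℤ.pos-* (5 * i) i) ⟩
    + (5 * i) ℤ.* + i ℤ.+ + i   ≡⟨ cong (λ z → z ℤ.* + i ℤ.+ + i) (ℤ.pos-* 5 i) ⟩
    + 5 ℤ.* + i ℤ.* + i ℤ.+ + i ∎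
    where open ≡-Reasoning
  double-pent -[1+ i ] = begin
    + 2 ℤ.* + (ε 0 i + (4 * i + 2))
      ≡⟨ cong (+ 2 ℤ.*_) (ℤ.pos-+ (ε 0 i) (4 * i + 2)) ⟩
    + 2 ℤ.* (+ ε 0 i ℤ.+ + (4 * i + 2))
      ≡⟨ cong (λ z → + 2 ℤ.* (+ ε 0 i ℤ.+ z)) (trans (ℤ.pos-+ (4 * i) 2) (cong (ℤ._+ + 2) (ℤ.pos-* 4 i))) ⟩
    + 2 ℤ.* (+ ε 0 i ℤ.+ (+ 4 ℤ.* + i ℤ.+ + 2))
      ≡⟨ ℤ.*-distribˡ-+ (+ 2) (+ ε 0 i) (+ 4 ℤ.* + i ℤ.+ + 2) ⟩
    + 2 ℤ.* + ε 0 i ℤ.+ + 2 ℤ.* (+ 4 ℤ.* + i ℤ.+ + 2)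
      ≡⟨ cong (ℤ._+ + 2 ℤ.* (+ 4 ℤ.* + i ℤ.+ + 2)) (double-pent (+ i)) ⟩
    + 5 ℤ.* + i ℤ.* + i ℤ.+ + i ℤ.+ + 2 ℤ.* (+ 4 ℤ.* + i ℤ.+ + 2)
      ≡⟨ arith (+ i) ⟩
    + 5 ℤ.* ℤ.- (+ 1 ℤ.+ + i) ℤ.* ℤ.- (+ 1 ℤ.+ + i) ℤ.+ ℤ.- (+ 1 ℤ.+ + i) ∎
    where
    open ≡-Reasoning
    arith : ∀ x → + 5 ℤ.* x ℤ.* x ℤ.+ x ℤ.+ + 2 ℤ.* (+ 4 ℤ.* x ℤ.+ + 2) ≡
      + 5 ℤ.* ℤ.- (+ 1 ℤ.+ x) ℤ.* ℤ.- (+ 1 ℤ.+ x) ℤ.+ ℤ.- (+ 1 ℤ.+ x)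
    arith = ℤSolver.solve-∀

  ε-mono : ∀ {i k} → i ≤ k → ε 0 i ≤ ε 0 k
  ε-mono {k = k}     z≤n       = z≤n
  ε-mono {suc i} {suc k} (s≤s i≤k) = +-mono-≤ (ε-mono i≤k) (+-monoˡ-≤ 3 (*-monoʳ-≤ 5 i≤k))

  -- The exponents interlace as 0 < 2 < 3 < 9 < 11 < ..., with j = 0, -1, 1, -2, 2, ...; hence no
  -- two of them coincide and cancel modulo 2.
  pent-neg<ε : ∀ i → pent -[1+ i ] < ε 0 (suc i)
  pent-neg<ε i = subst (suc (ε 0 i + (4 * i + 2)) ≤_) (arith (ε 0 i) i) (m≤m+n _ i)
    where
    arith : ∀ e i → suc (e + (4 * i + 2)) + i ≡ e + (5 * i + 3)
    arith = solve-∀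

  indicator : ℕ → ℕ → Bool
  indicator n i = shift (ε 0 i) δ n xor shift (pent -[1+ i ]) δ n

  indicator-false : ∀ n i → n ≢ pent (+ i) → n ≢ pent -[1+ i ] → indicator n i ≡ false
  indicator-false n i ≢₁ ≢₂ = cong₂ _xor_ (shift-δ-≢ _ n ≢₁) (shift-δ-≢ _ n ≢₂)

  -- At m = 0 each `∏ n 0` is the constant 1, so Rogers' series is already the theta series, with
  -- the terms j = i and j = -i-1 paired.
  Q₂-indicator : ∀ N n → Q₂ N 0 n ≡ ∑ N (indicator n)
  Q₂-indicator N n = ∑-cong N (λ i _ → shift-[1+q^] (ε 0 i) (4 * i + 2) δ n)

  -- By the interlacing, both exponents of an earlier pair lie below n and both exponents of a later
  -- pair lie above it.
  indicator-unique : ∀ n i → ε 0 i ≤ n → n < ε 0 (suc i) → ∑ (suc n) (indicator n) ≡ indicator n i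
  indicator-unique n i ≤n n< = ∑-single (suc n) (indicator n) i (s≤s (≤-trans (n≤ε 0 i) ≤n)) elsewhere
    where
    elsewhere : ∀ k → k ≢ i → indicator n k ≡ false
    elsewhere k k≢i with <-cmp k i
    ... | tri≈ _ k≡i _ = contradiction k≡i k≢i
    ... | tri< k<i _ _ = indicator-false n k
            (>⇒≢ (≤-<-trans (m≤m+n _ _) neg<)) (>⇒≢ neg<)
      where
      neg< : pent -[1+ k ] < n
      neg< = <-≤-trans (pent-neg<ε k) (≤-trans (ε-mono k<i) ≤n)
    ... | tri> _ _ i<k = indicator-false n k
            (<⇒≢ n<ε) (<⇒≢ (<-≤-trans n<ε (m≤m+n _ _)))
      where
      n<ε : n < ε 0 k
      n<ε = <-≤-trans n< (ε-mono i<k)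

  ∑-indicator-pent : ∀ j → ∑ (suc (pent j)) (indicator (pent j)) ≡ true
  ∑-indicator-pent (+ i) = trans
    (indicator-unique (ε 0 i) i ≤-refl (≤-<-trans (m≤m+n _ _) (pent-neg<ε i)))
    (cong₂ _xor_ (shift-δ (ε 0 i)) (shift-small (pent -[1+ i ]) δ (m<m+n (ε 0 i) (≤-trans (s≤s z≤n) (m≤n+m 2 (4 * i))))))
  ∑-indicator-pent -[1+ i ] = trans
    (indicator-unique (pent -[1+ i ]) i (m≤m+n _ _) (pent-neg<ε i))
    (cong₂ _xor_ (shift-δ-≢ (ε 0 i) _ (>⇒≢ (m<m+n (ε 0 i) (≤-trans (s≤s z≤n) (m≤n+m 2 (4 * i)))))) (shift-δ (pent -[1+ i ])))

  c9-indicator : ∀ n → c9 n % 2 ≡ bit (∑ (suc n) (indicator n))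
  c9-indicator n = trans (c9-sumSide n) (cong bit
    -- The descent has depth n: it starts at parameter n, where both sides agree up to q^n, and ends
    -- at parameter 0.
    (trans (sumSide≡Q₂ n n 0 (m≤m+n n 0) ≤-refl) (Q₂-indicator (suc n) n)))

  c9-odd : ∀ j → c9 (pent j) % 2 ≡ 1
  c9-odd j = trans (c9-indicator (pent j)) (cong bit (∑-indicator-pent j))

  c9-even : ∀ n → (∀ j → n ≢ pent j) → c9 n % 2 ≡ 0
  c9-even n n≢pent = trans (c9-indicator n) (cong bit (∑-false (suc n) (λ i _ →
    indicator-false n i (n≢pent (+ i)) (n≢pent -[1+ i ]))))

  double-injective : ∀ m n → + 2 ℤ.* + m ≡ + 2 ℤ.* + n → m ≡ n
  double-injective m n eq = ℤ.+-injective (ℤ.*-cancelˡ-≡ (+ 2) (+ m) (+ n) eq)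

open PentagonalExponents
open import Data.Integer using (ℤ; +_; _+_; _*_)

theorem10 : (n : ℕ) →
    ((∃ λ (j : ℤ) → + 2 * + n ≡ + 5 * j * j + j) → c9 n % 2 ≡ 1) ×
    ((¬ ∃ λ (j : ℤ) → + 2 * + n ≡ + 5 * j * j + j) → c9 n % 2 ≡ 0)
theorem10 n =
    (λ (j , eq) → subst (λ k → c9 k % 2 ≡ 1)
      (double-injective (pent j) n (trans (double-pent j) (sym eq))) (c9-odd j))
  , (λ ∄j → c9-even n (λ { j refl → ∄j (j , double-pent j) }))
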